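{- Let $n$ be an even positive integer and let $G=\mathrm{Cay}(\mathbb{Z}_n,S)$ be a circulant graph of order $n$ with generating set $S$ such that $|S|=\frac n2-2$, $s_i+s_j\ne\frac n2$ for all $s_i,s_j\in S$, and $\frac n2\notin S$. Then $\chi''(G)\le\frac n2+1=\Delta(G)+3$.
   Context: All graphs are finite, simple and undirected. For a group $H$ and a symmetric generating set $S\subset H$ (that is, $s\in S$ implies $s^{ -1}\in S$) not containing the identity, the Cayley graph $\mathrm{Cay}(H,S)$ has vertex set $H$ and edges joining $g$ and $gs$ for $g\in H$, $s\in S$. A circulant graph is a Cayley graph on the cyclic group $H=\mathbb{Z}_n$, whose elements are written $0,1,\ldots,n-1$; sums of elements of $S$ are taken in $\mathbb{Z}_n$. A total coloring of $G$ is a coloring of its vertices and edges such that no two adjacent vertices, no two adjacent edges, and no edge and a vertex incident with it receive the same color; $\chi''(G)$ is the minimum number of colors in a total coloring, and $\Delta(G)$ is the maximum degree. -}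

module Defs where

open import Algebra.Core using (Op₁; Op₂)
open import Algebra.Structures using (IsGroup)
open import Data.Fin.Base
  using (Fin; toℕ; finToFun; funToFin; splitAt; _↑ˡ_; _↑ʳ_)
open import Data.Fin.Properties
  using (_≟_; all?; any?; toℕ-injective; toℕ-fromℕ<; toℕ<n; nonZeroIndex;
         finToFun-funToFin; ↑ˡ-injective; ↑ʳ-injective; splitAt-↑ˡ; splitAt-↑ʳ)
open import Data.Fin.Subset using (Subset; _∈_; _∉_; ∣_∣)
open import Data.Fin.Subset.Properties using (_∈?_)
open import Data.Nat.Base
  using (ℕ; zero; suc; _+_; _∸_; _≤_; _⊔_; _%_; NonZero; z≤n; s≤s)
open import Data.Nat.DivMod
  using (_mod_; %-distribˡ-+; m%n%n≡m%n; m<n⇒m%n≡m; n%n≡0; m%n<n)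
open import Data.Nat.Properties
  using (+-comm; +-assoc; m∸n+n≡m; <⇒≤)
open import Data.Product.Base using (∃; ∃-syntax; _×_; _,_; proj₁; proj₂)
open import Data.Vec.Base using (tabulate)
import Data.Vec.Functional as Vector
open import Function.Base using (_∘_)
open import Level using (0ℓ)
open import Relation.Binary.Core using (Rel)
open import Relation.Binary.Definitions as B using (Symmetric; Irreflexive)
open import Relation.Binary.PropositionalEquality
  using (_≡_; _≢_; _≗_; refl; sym; trans; cong; cong₂; subst; isEquivalence;
         module ≡-Reasoning)
open import Relation.Nullary.Decidable
  using (Dec; yes; no; does; map′; _×-dec_; _→-dec_; ¬?)
open import Relation.Nullary.Negation using (contradiction)
open import Relation.Unary using (Pred; Decidable)

record Graph (n : ℕ) : Set₁ where
  field
    Adj    : Rel (Fin n) 0ℓ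
    adj?   : B.Decidable Adj
    symm   : Symmetric Adj
    irrefl : Irreflexive _≡_ Adj

  neighbours : Fin n → Subset n
  neighbours u = tabulate (λ v → does (adj? u v))

  degree : Fin n → ℕ
  degree u = ∣ neighbours u ∣

Δ : ∀ {n} → Graph n → ℕ
Δ G = Vector.foldr _⊔_ 0 (Graph.degree G)

-- An edge is presented by its two orientations; `edge-sym` makes its colour
-- independent of the orientation and of the adjacency proof.  Hence it is
-- enough to compare edges that share their first endpoint, and an edge with
-- its first endpoint.
record TotalColoring {n : ℕ} (G : Graph n) (k : ℕ) : Set where
  open Graph G
  field
    vertex        : Fin n → Fin k
    edge          : ∀ {u v} → Adj u v → Fin k
    edge-sym      : ∀ {u v} (p : Adj u v) (q : Adj v u) → edge p ≡ edge q
    vertex-proper : ∀ {u v} → Adj u v → vertex u ≢ vertex v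
    edge-proper   : ∀ {u v w} (p : Adj u v) (q : Adj u w) → v ≢ w →
                    edge p ≢ edge q
    incident      : ∀ {u v} (p : Adj u v) → edge p ≢ vertex u

IsLeast : Pred ℕ 0ℓ → Pred ℕ 0ℓ
IsLeast P k = P k × (∀ {j} → P j → k ≤ j)

least : ∀ {P : Pred ℕ 0ℓ} → Decidable P → ∀ k → P k → ∃ (IsLeast P)
least P? k pk with P? 0
... | yes p0 = 0 , p0 , λ _ → z≤n
least P? zero    pk | no ¬p0 = contradiction pk ¬p0
least {P} P? (suc k) pk | no ¬p0 =
  let m , pm , min = least (P? ∘ suc) k pk
  in suc m , pm , λ { {zero} p → contradiction p ¬p0 ; {suc _} p → s≤s (min p) }

module _ {n : ℕ} .{{_ : NonZero n}} where

  infixl 6 _⊕_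
  infix  8 ⊖_

  _⊕_ : Op₂ (Fin n)
  i ⊕ j = (toℕ i + toℕ j) mod n

  0ₙ : Fin n
  0ₙ = 0 mod n

  ⊖_ : Op₁ (Fin n)
  ⊖ i = (n ∸ toℕ i) mod n

  private
    toℕ-mod : ∀ m → toℕ (m mod n) ≡ m % n
    toℕ-mod m = toℕ-fromℕ< (m%n<n m n)

    mod-cong : ∀ a b → a % n ≡ b % n → a mod n ≡ b mod n
    mod-cong a b eq =
      toℕ-injective (trans (toℕ-mod a) (trans eq (sym (toℕ-mod b))))

    toℕ-mod-id : ∀ i → toℕ i mod n ≡ i
    toℕ-mod-id i = toℕ-injective (trans (toℕ-mod _) (m<n⇒m%n≡m (toℕ<n i)))

    %-absorbˡ : ∀ a b → (a % n + b) % n ≡ (a + b) % n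
    %-absorbˡ a b = begin
      (a % n + b) % n          ≡⟨ %-distribˡ-+ (a % n) b n ⟩
      (a % n % n + b % n) % n  ≡⟨ cong (λ x → (x + b % n) % n) (m%n%n≡m%n a n) ⟩
      (a % n + b % n) % n      ≡⟨ %-distribˡ-+ a b n ⟨
      (a + b) % n              ∎
      where open ≡-Reasoning

    mod-⊕ : ∀ a j → (a mod n) ⊕ j ≡ (a + toℕ j) mod n
    mod-⊕ a j = mod-cong _ _
      (trans (cong (λ x → (x + toℕ j) % n) (toℕ-mod a)) (%-absorbˡ a (toℕ j)))

  ⊕-comm : ∀ i j → i ⊕ j ≡ j ⊕ i
  ⊕-comm i j = cong (λ m → m mod n) (+-comm (toℕ i) (toℕ j))

  ⊕-assoc : ∀ i j k → (i ⊕ j) ⊕ k ≡ i ⊕ (j ⊕ k)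
  ⊕-assoc i j k = begin
    (i ⊕ j) ⊕ k                        ≡⟨ mod-⊕ (toℕ i + toℕ j) k ⟩
    (toℕ i + toℕ j + toℕ k) mod n      ≡⟨ cong (λ m → m mod n) (trans (+-assoc (toℕ i) _ _) (+-comm (toℕ i) _)) ⟩
    (toℕ j + toℕ k + toℕ i) mod n      ≡⟨ mod-⊕ (toℕ j + toℕ k) i ⟨
    (j ⊕ k) ⊕ i                        ≡⟨ ⊕-comm (j ⊕ k) i ⟩
    i ⊕ (j ⊕ k)                        ∎
    where open ≡-Reasoning

  ⊕-identityˡ : ∀ i → 0ₙ ⊕ i ≡ i
  ⊕-identityˡ i = trans (mod-⊕ 0 i) (toℕ-mod-id i)

  ⊖-inverseˡ : ∀ i → (⊖ i) ⊕ i ≡ 0ₙ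
  ⊖-inverseˡ i = trans (mod-⊕ (n ∸ toℕ i) i) (mod-cong _ _
    (trans (cong (_% n) (m∸n+n≡m (<⇒≤ (toℕ<n i)))) (trans (n%n≡0 n) (sym (0%n n)))))
    where
    0%n : ∀ m .{{_ : NonZero m}} → 0 % m ≡ 0
    0%n (suc _) = refl

  ⊕-cancelˡ : ∀ i {j k} → i ⊕ j ≡ i ⊕ k → j ≡ k
  ⊕-cancelˡ i {j} {k} eq = begin
    j                ≡⟨ ⊕-identityˡ j ⟨
    0ₙ ⊕ j           ≡⟨ cong (_⊕ j) (⊖-inverseˡ i) ⟨
    ⊖ i ⊕ i ⊕ j      ≡⟨ ⊕-assoc (⊖ i) i j ⟩
    ⊖ i ⊕ (i ⊕ j)    ≡⟨ cong (⊖ i ⊕_) eq ⟩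
    ⊖ i ⊕ (i ⊕ k)    ≡⟨ ⊕-assoc (⊖ i) i k ⟨
    ⊖ i ⊕ i ⊕ k      ≡⟨ cong (_⊕ k) (⊖-inverseˡ i) ⟩
    0ₙ ⊕ k           ≡⟨ ⊕-identityˡ k ⟩
    k                ∎
    where open ≡-Reasoning

ℤ/-isGroup : ∀ n .{{_ : NonZero n}} → IsGroup {A = Fin n} _≡_ _⊕_ 0ₙ ⊖_
ℤ/-isGroup n = record
  { isMonoid = record
    { isSemigroup = record
      { isMagma = record { isEquivalence = isEquivalence ; ∙-cong = cong₂ _⊕_ }
      ; assoc = ⊕-assoc }
    ; identity = ⊕-identityˡ , λ i → trans (⊕-comm i 0ₙ) (⊕-identityˡ i) }
  ; inverse = ⊖-inverseˡ , λ i → trans (⊕-comm i (⊖ i)) (⊖-inverseˡ i)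
  ; ⁻¹-cong = cong ⊖_ }

module _ {n : ℕ} (G : Graph n) where
  open Graph G

  private
    -- Colour tables defined on all pairs, so that they can be enumerated;
    -- entries at non-adjacent pairs are ignored.
    Proper : ∀ {k} → (Fin n → Fin k) → (Fin n → Fin n → Fin k) → Set
    Proper c e = ∀ u v → Adj u v →
      e u v ≡ e v u × c u ≢ c v × e u v ≢ c u ×
      (∀ w → Adj u w → v ≢ w → e u v ≢ e u w)

    proper? : ∀ {k} c e → Dec (Proper {k} c e)
    proper? c e = all? λ u → all? λ v → adj? u v →-dec
      (e u v ≟ e v u ×-dec ¬? (c u ≟ c v) ×-dec ¬? (e u v ≟ c u) ×-dec
       all? λ w → adj? u w →-dec (¬? (v ≟ w) →-dec ¬? (e u v ≟ e u w)))

    Proper-resp : ∀ {k} {c c′ : Fin n → Fin k} {e e′ : Fin n → Fin n → Fin k} →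
      c ≗ c′ → (∀ u → e u ≗ e′ u) → Proper c e → Proper c′ e′
    Proper-resp c≗ e≗ pr u v a with pr u v a
    ... | s , vp , inc , ep =
        trans (sym (e≗ u v)) (trans s (e≗ v u))
      , (λ eq → vp (trans (c≗ u) (trans eq (sym (c≗ v)))))
      , (λ eq → inc (trans (e≗ u v) (trans eq (sym (c≗ u)))))
      , λ w b v≢w eq → ep w b v≢w (trans (e≗ u v) (trans eq (sym (e≗ u w))))

    fromTable : ∀ {k} c e → Proper {k} c e → TotalColoring G k
    fromTable c e pr = record
      { vertex        = c
      ; edge          = λ {u} {v} _ → e u v
      ; edge-sym      = λ {u} {v} p _ → proj₁ (pr u v p)
      ; vertex-proper = λ {u} {v} p → proj₁ (proj₂ (pr u v p))
      ; edge-proper   = λ {u} {v} {w} p q → proj₂ (proj₂ (proj₂ (pr u v p))) w q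
      ; incident      = λ {u} {v} p → proj₁ (proj₂ (proj₂ (pr u v p)))
      }

    module _ {k : ℕ} (t : TotalColoring G k) where
      open TotalColoring t

      table : Fin n → Fin n → Fin k
      table u v with adj? u v
      ... | yes p = edge p
      ... | no  _ = vertex u

      table-edge : ∀ {u v} (p : Adj u v) → table u v ≡ edge p
      table-edge {u} {v} p with adj? u v
      ... | yes q = trans (edge-sym q (symm q)) (sym (edge-sym p (symm q)))
      ... | no ¬p = contradiction p ¬p

      toTable : Proper vertex table
      toTable u v p =
          trans (table-edge p) (trans (edge-sym p (symm p)) (sym (table-edge (symm p))))
        , vertex-proper p
        , (λ eq → incident p (trans (sym (table-edge p)) eq))
        , λ w q v≢w eq → edge-proper p q v≢w
            (trans (sym (table-edge p)) (trans eq (table-edge q)))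

  totalColoring? : Decidable (TotalColoring G)
  totalColoring? k = map′ to from
    (any? λ i → any? λ j → proper? (vtx i) (edg j))
    where
    vtx : _ → Fin n → Fin k
    vtx = finToFun

    edg : _ → Fin n → Fin n → Fin k
    edg j u = finToFun (finToFun j u)

    to : (∃[ i ] ∃[ j ] Proper (vtx i) (edg j)) → TotalColoring G k
    to (i , j , pr) = fromTable (vtx i) (edg j) pr

    from : TotalColoring G k → ∃[ i ] ∃[ j ] Proper (vtx i) (edg j)
    from t = funToFin (TotalColoring.vertex t)
           , funToFin (funToFin ∘ table t)
           , Proper-resp
               (λ u → sym (finToFun-funToFin _ u))
               (λ u v → sym (trans
                 (cong (λ x → finToFun {k} {n} x v) (finToFun-funToFin (funToFin ∘ table t) u))
                 (finToFun-funToFin (table t u) v)))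
               (toTable t)

  -- Distinct colours on the vertices, and the colour u + v (mod n) from a
  -- disjoint palette on the edge uv.
  trivialColoring : TotalColoring G (n + n)
  trivialColoring = fromTable (_↑ˡ n) (λ u v → n ↑ʳ add u v) λ u v p →
      cong (n ↑ʳ_) (⊕-comm {{nonZeroIndex u}} u v)
    , (λ eq → irrefl (↑ˡ-injective n u v eq) p)
    , (λ eq → disjoint u (add u v) (sym eq))
    , λ w _ v≢w eq → v≢w (⊕-cancelˡ {{nonZeroIndex u}} u (↑ʳ-injective n _ _ eq))
    where
    add : Op₂ (Fin n)
    add u v = _⊕_ {{nonZeroIndex u}} u v

    disjoint : ∀ (i j : Fin n) → i ↑ˡ n ≢ n ↑ʳ j
    disjoint i j eq
      with () ← trans (sym (splitAt-↑ˡ n i n))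
                      (trans (cong (splitAt n) eq) (splitAt-↑ʳ n n j))

  private
    leastColoring : ∃ (IsLeast (TotalColoring G))
    leastColoring = least totalColoring? (n + n) trivialColoring

  χ″ : ℕ
  χ″ = proj₁ leastColoring

  χ″-isLeast : IsLeast (TotalColoring G) χ″
  χ″-isLeast = proj₂ leastColoring

module _ {n : ℕ} {_∙_ : Op₂ (Fin n)} {ε : Fin n} {_⁻¹ : Op₁ (Fin n)}
         (isGroup : IsGroup _≡_ _∙_ ε _⁻¹) where
  open IsGroup isGroup using (assoc; identityˡ; identityʳ; inverseˡ; inverseʳ)

  data ⟨_⟩ (S : Subset n) : Pred (Fin n) 0ℓ where
    gen : ∀ {g} → g ∈ S → ⟨ S ⟩ g
    one : ⟨ S ⟩ ε
    mul : ∀ {g h} → ⟨ S ⟩ g → ⟨ S ⟩ h → ⟨ S ⟩ (g ∙ h)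
    inv : ∀ {g} → ⟨ S ⟩ g → ⟨ S ⟩ (g ⁻¹)

  record IsCayleySet (S : Subset n) : Set where
    field
      symmetric  : ∀ {s} → s ∈ S → (s ⁻¹) ∈ S
      ε∉S        : ε ∉ S
      generating : ∀ g → ⟨ S ⟩ g

  Cay : (S : Subset n) → IsCayleySet S → Graph n
  Cay S isCayleySet = record
    { Adj    = λ g h → ∃[ s ] (s ∈ S × h ≡ g ∙ s)
    ; adj?   = λ g h → any? λ s → s ∈? S ×-dec h ≟ (g ∙ s)
    ; symm   = λ { {g} (s , s∈S , refl) → (s ⁻¹) , symmetric s∈S , undo g s }
    ; irrefl = λ { {g} refl (s , s∈S , g≡gs) →
                   ε∉S (subst (_∈ S) (s≡ε g s g≡gs) s∈S) }
    }
    where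
    open IsCayleySet isCayleySet

    undo : ∀ g s → g ≡ (g ∙ s) ∙ (s ⁻¹)
    undo g s = sym (trans (assoc g s (s ⁻¹))
                     (trans (cong (g ∙_) (inverseʳ s)) (identityʳ g)))

    s≡ε : ∀ g s → g ≡ g ∙ s → s ≡ ε
    s≡ε g s eq = trans (sym (identityˡ s)) (trans
      (cong (_∙ s) (sym (inverseˡ g))) (trans
      (assoc (g ⁻¹) g s) (trans
      (cong ((g ⁻¹) ∙_) (sym eq)) (inverseˡ g))))

{-# OPTIONS --safe #-}
-- Since S = -S, the conditions on S say that reduction mod m = n/2 is injective
-- on {0} ∪ S.  So u ↦ u mod m maps the graph to the complete graph on
-- {0, …, m - 1} and is injective on every closed neighbourhood; total colourings
-- pull back along such maps.  For k odd, m ≤ k ≤ m + 1, the residues mod k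
-- totally colour the complete graph: i gets 2i and ij gets i + j.
module Submission where

open import Defs
open import Algebra.Bundles using (Group)
open import Algebra.Core using (Op₁; Op₂)
import Algebra.Properties.CommutativeMonoid.Sum as Sum
import Algebra.Properties.Group as GroupProperties
open import Algebra.Structures using (IsGroup)
open import Data.Bool.Base using (Bool; true; false; if_then_else_)
open import Data.Fin.Base using (Fin; toℕ; zero; suc)
open import Data.Fin.Permutation using (Permutation; permutation; _⟨$⟩ʳ_)
open import Data.Fin.Properties using (toℕ-injective; toℕ-fromℕ<; toℕ<n)
open import Data.Fin.Subset using (Subset; _∈_; _∉_; ∣_∣)
open import Data.Fin.Subset.Properties using (_∈?_)
open import Data.Nat using (ℕ; zero; suc; NonZero; _+_; _*_; _≤_; _<_; _⊔_; _/_; _%_; z≤n; s≤s; s≤s⁻¹; >-nonZero)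
open import Data.Nat.DivMod
  using (_mod_; m%n<n; m%n%n≡m%n; m<n⇒m%n≡m; m≡m%n+[m/n]*n; [m+kn]%n≡m%n; %-distribˡ-*;
         [m+n]%n≡m%n; m<n*o⇒m/o<n; m/n*n≡m; m/n*n≤m)
open import Data.Nat.Divisibility using (_∣_)
open import Data.Nat.Properties
  using (+-0-commutativeMonoid; +-assoc; +-comm; +-monoˡ-≤; *-comm; ⊔-idem; ⊔-identityʳ;
         <-≤-trans; m<m*n; m≤n⇒m≤o+n; module ≤-Reasoning)
open import Data.Nat.Solver using (module +-*-Solver)
open import Data.Product using (_×_; _,_; proj₂)
open import Data.Sum.Base using (_⊎_; inj₁; inj₂)
open import Data.Vec.Base using (_∷_; tabulate; lookup)
import Data.Vec.Functional as Vector
open import Data.Vec.Properties using (tabulate∘lookup)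
open import Function.Base using (_∘_)
open import Function.Bundles using (_⇔_; mk⇔)
open import Relation.Binary.PropositionalEquality
  using (_≡_; _≢_; refl; sym; trans; cong; cong₂; subst; module ≡-Reasoning)
open import Relation.Nullary.Decidable using (does; does-⇔)
open import Relation.Nullary.Negation using (¬_)

-- Cardinalities of subsets and the maximum degree of a Cayley graph.

module ℕΣ = Sum +-0-commutativeMonoid

-- Writes a cardinality as a sum of indicators, so that the invariance of finite sums under
-- permutation applies to it.
∣tabulate∣≡sum : ∀ {n} (f : Fin n → Bool) →
  ∣ tabulate f ∣ ≡ ℕΣ.sum (λ i → if f i then 1 else 0)
∣tabulate∣≡sum {zero}  f = refl
∣tabulate∣≡sum {suc n} f with f zero
... | true  = cong suc (∣tabulate∣≡sum (f ∘ suc))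
... | false = ∣tabulate∣≡sum (f ∘ suc)

∣tabulate∣-permute : ∀ {m n} (f : Fin n → Bool) (g : Fin m → Bool)
  (π : Permutation m n) → (∀ i → f (π ⟨$⟩ʳ i) ≡ g i) →
  ∣ tabulate f ∣ ≡ ∣ tabulate g ∣
∣tabulate∣-permute f g π f∘π≗g = begin
  ∣ tabulate f ∣                                  ≡⟨ ∣tabulate∣≡sum f ⟩
  ℕΣ.sum (λ i → if f i then 1 else 0)             ≡⟨ ℕΣ.sum-permute (λ i → if f i then 1 else 0) π ⟩
  ℕΣ.sum (λ i → if f (π ⟨$⟩ʳ i) then 1 else 0)    ≡⟨ ℕΣ.sum-cong-≗ (λ i → cong (if_then 1 else 0) (f∘π≗g i)) ⟩
  ℕΣ.sum (λ i → if g i then 1 else 0)             ≡⟨ ∣tabulate∣≡sum g ⟨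
  ∣ tabulate g ∣                                  ∎
  where open ≡-Reasoning

does-∈?≡lookup : ∀ {n} i (S : Subset n) → does (i ∈? S) ≡ lookup S i
does-∈?≡lookup zero    (true  ∷ S) = refl
does-∈?≡lookup zero    (false ∷ S) = refl
does-∈?≡lookup (suc i) (_     ∷ S) = does-∈?≡lookup i S

foldr-⊔-const : ∀ {n d} .{{_ : NonZero n}} (f : Fin n → ℕ) → (∀ i → f i ≡ d) →
  Vector.foldr _⊔_ 0 f ≡ d
foldr-⊔-const {suc zero}    f f≗d = trans (⊔-identityʳ _) (f≗d zero)
foldr-⊔-const {suc (suc n)} f f≗d =
  trans (cong₂ _⊔_ (f≗d zero) (foldr-⊔-const (f ∘ suc) (f≗d ∘ suc))) (⊔-idem _)

module _ {n : ℕ} {_∙_ : Op₂ (Fin n)} {ε : Fin n} {_⁻¹ : Op₁ (Fin n)}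
         (isGroup : IsGroup _≡_ _∙_ ε _⁻¹) where

  private
    group : Group _ _
    group = record { isGroup = isGroup }

    open GroupProperties group

  translation : Fin n → Permutation n n
  translation u = permutation (u ∙_) ((u ⁻¹) ∙_) (\\-leftDividesˡ u) (\\-leftDividesʳ u)

  module _ (S : Subset n) (isCayleySet : IsCayleySet isGroup S) where
    open Graph (Cay isGroup S isCayleySet)

    -- Left translation by `u` carries `S` bijectively onto the neighbours of `u`: by cancellation,
    -- `u ∙ s` is adjacent to `u` exactly when `s ∈ S`.
    degree-Cay : ∀ u → degree u ≡ ∣ S ∣
    degree-Cay u = trans
      (∣tabulate∣-permute (does ∘ adj? u) (lookup S) (translation u) neighbour≗)
      (cong ∣_∣ (tabulate∘lookup S))
      where
      translate⇔∈ : ∀ s → Adj u (u ∙ s) ⇔ s ∈ S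
      translate⇔∈ s = mk⇔
        (λ { (s′ , s′∈S , us≡us′) → subst (_∈ S) (sym (∙-cancelˡ u s s′ us≡us′)) s′∈S })
        (λ s∈S → s , s∈S , refl)

      neighbour≗ : ∀ s → does (adj? u (u ∙ s)) ≡ lookup S s
      neighbour≗ s = trans
        (does-⇔ (translate⇔∈ s) (adj? u (u ∙ s)) (s ∈? S)) (does-∈?≡lookup s S)

    Δ-Cay : .{{_ : NonZero n}} → Δ (Cay isGroup S isCayleySet) ≡ ∣ S ∣
    Δ-Cay = foldr-⊔-const degree degree-Cay

-- Total colourings by residues modulo an odd number.

toℕ-mod : ∀ m n .{{_ : NonZero n}} → toℕ (m mod n) ≡ m % n
toℕ-mod m n = toℕ-fromℕ< (m%n<n m n)

-- j + 1 is the inverse of 2 modulo 2j + 1.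
⊕-double-injective : ∀ j {a b : Fin (suc (j * 2))} → a ⊕ a ≡ b ⊕ b → a ≡ b
⊕-double-injective j {a} {b} 2a≡2b = toℕ-injective (begin
  toℕ a                                ≡⟨ halve a ⟨
  (suc j * toℕ (a ⊕ a)) % k            ≡⟨ cong (λ c → (suc j * toℕ c) % k) 2a≡2b ⟩
  (suc j * toℕ (b ⊕ b)) % k            ≡⟨ halve b ⟩
  toℕ b                                ∎)
  where
  open ≡-Reasoning
  k = suc (j * 2)

  halve : ∀ (c : Fin k) → (suc j * toℕ (c ⊕ c)) % k ≡ toℕ c
  halve c = begin
    (suc j * toℕ (c ⊕ c)) % k                   ≡⟨ cong (λ x → (suc j * x) % k) (toℕ-mod (x + x) k) ⟩
    (suc j * ((x + x) % k)) % k                 ≡⟨ %-distribˡ-* (suc j) ((x + x) % k) k ⟩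
    (suc j % k * ((x + x) % k % k)) % k         ≡⟨ cong (λ y → (suc j % k * y) % k) (m%n%n≡m%n (x + x) k) ⟩
    (suc j % k * ((x + x) % k)) % k             ≡⟨ %-distribˡ-* (suc j) (x + x) k ⟨
    (suc j * (x + x)) % k                       ≡⟨ cong (_% k) (solve 2 (λ j x →
                                                     (con 1 :+ j) :* (x :+ x) := x :+ x :* (con 1 :+ j :* con 2))
                                                     refl j x) ⟩
    (x + x * k) % k                             ≡⟨ [m+kn]%n≡m%n x x k ⟩
    x % k                                       ≡⟨ m<n⇒m%n≡m (toℕ<n c) ⟩
    x                                           ∎
    where
    open +-*-Solver
    x = toℕ c

-- The colours seen at `u`, its own and those of its edges, are the values of translation by `f u`
-- at `f u` and at the images of the neighbours. Translations are injective, so these colours differ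
-- as soon as `f` is injective on the closed neighbourhood. Oddness of the number of colours serves
-- to separate adjacent vertices, through doubling.
totalColoring-pullback : ∀ {n} (G : Graph n) j (f : Fin n → Fin (suc (j * 2))) →
  (∀ {u v} → Graph.Adj G u v → f u ≢ f v) →
  (∀ {u v w} → Graph.Adj G u v → Graph.Adj G u w → v ≢ w → f v ≢ f w) →
  TotalColoring G (suc (j * 2))
totalColoring-pullback G j f f-proper f-locallyInjective = record
  { vertex        = λ u → f u ⊕ f u
  ; edge          = λ {u} {v} _ → f u ⊕ f v
  ; edge-sym      = λ {u} {v} _ _ → ⊕-comm (f u) (f v)
  ; vertex-proper = λ p → f-proper p ∘ ⊕-double-injective j
  ; edge-proper   = λ {u} p q v≢w → f-locallyInjective p q v≢w ∘ ⊕-cancelˡ (f u)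
  ; incident      = λ {u} p → f-proper p ∘ sym ∘ ⊕-cancelˡ (f u)
  }

-- Reduction modulo half the order.

-- Below `n = 2m` the quotient by `m` is 0 or 1. With a common remainder, equal quotients give equal
-- elements, and different ones give elements at distance `m`.
%-half : ∀ {n m} .{{_ : NonZero n}} .{{_ : NonZero m}} → m * 2 ≡ n → (v w : Fin n) →
  toℕ v % m ≡ toℕ w % m → v ≡ w ⊎ v ≡ w ⊕ (m mod n)
%-half {n} {m} m*2≡n v w v%m≡w%m =
  cases (toℕ v / m) (toℕ w / m) (quotient<2 v) (quotient<2 w)
    (m≡m%n+[m/n]*n (toℕ v) m)
    (trans (m≡m%n+[m/n]*n (toℕ w) m) (cong (_+ _) (sym v%m≡w%m)))
  where
  open ≡-Reasoning
  open +-*-Solver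

  r = toℕ v % m

  quotient<2 : ∀ (u : Fin n) → toℕ u / m < 2
  quotient<2 u = m<n*o⇒m/o<n
    (subst (toℕ u <_) (trans (sym m*2≡n) (*-comm m 2)) (toℕ<n u))

  m<n : m < n
  m<n = subst (m <_) m*2≡n (m<m*n m 2 (s≤s (s≤s z≤n)))

  toℕ-shift : ∀ (u : Fin n) → toℕ (u ⊕ (m mod n)) ≡ (toℕ u + m) % n
  toℕ-shift u = trans (toℕ-mod _ n)
    (cong (λ x → (toℕ u + x) % n) (trans (toℕ-mod m n) (m<n⇒m%n≡m m<n)))

  cases : ∀ p q → p < 2 → q < 2 → toℕ v ≡ r + p * m → toℕ w ≡ r + q * m →
    v ≡ w ⊎ v ≡ w ⊕ (m mod n)
  cases 0 0 _ _ v≡ w≡ = inj₁ (toℕ-injective (trans v≡ (sym w≡)))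
  cases 1 1 _ _ v≡ w≡ = inj₁ (toℕ-injective (trans v≡ (sym w≡)))
  cases 1 0 _ _ v≡ w≡ = inj₂ (toℕ-injective (sym (begin
    toℕ (w ⊕ (m mod n))    ≡⟨ toℕ-shift w ⟩
    (toℕ w + m) % n        ≡⟨ cong (λ x → (x + m) % n) w≡ ⟩
    (r + 0 + m) % n        ≡⟨ cong (_% n) (solve 2 (λ r m → r :+ con 0 :+ m := r :+ con 1 :* m) refl r m) ⟩
    (r + 1 * m) % n        ≡⟨ cong (_% n) v≡ ⟨
    toℕ v % n              ≡⟨ m<n⇒m%n≡m (toℕ<n v) ⟩
    toℕ v                  ∎)))
  -- Here `w` is the larger element, so adding `m` to it wraps around: `w + m` is `v + n`.
  cases 0 1 _ _ v≡ w≡ = inj₂ (toℕ-injective (sym (begin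
    toℕ (w ⊕ (m mod n))    ≡⟨ toℕ-shift w ⟩
    (toℕ w + m) % n        ≡⟨ cong (λ x → (x + m) % n) w≡ ⟩
    (r + 1 * m + m) % n    ≡⟨ cong (_% n) (solve 2 (λ r m → r :+ con 1 :* m :+ m := r :+ con 0 :* m :+ m :* con 2) refl r m) ⟩
    (r + 0 * m + m * 2) % n  ≡⟨ cong₂ (λ x y → (x + y) % n) (sym v≡) m*2≡n ⟩
    (toℕ v + n) % n        ≡⟨ [m+n]%n≡m%n (toℕ v) n ⟩
    toℕ v % n              ≡⟨ m<n⇒m%n≡m (toℕ<n v) ⟩
    toℕ v                  ∎)))
  cases (suc (suc _)) _ (s≤s (s≤s ())) _
  cases _ (suc (suc _)) _ (s≤s (s≤s ()))

-- The right-hand side is the odd one of `m` and `m + 1`. It will be the number of colours, and the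
-- bound makes room for all residues modulo `m`.
m≤1+m/2*2 : ∀ m → m ≤ suc (m / 2 * 2)
m≤1+m/2*2 m = begin
  m                    ≡⟨ m≡m%n+[m/n]*n m 2 ⟩
  m % 2 + m / 2 * 2    ≤⟨ +-monoˡ-≤ (m / 2 * 2) (s≤s⁻¹ (m%n<n m 2)) ⟩
  suc (m / 2 * 2)      ∎
  where open ≤-Reasoning

-- Colouring the circulant graph.

module _ {n m : ℕ} .{{_ : NonZero n}} .{{_ : NonZero m}} (m*2≡n : m * 2 ≡ n)
         (S : Subset n) (isCayleySet : IsCayleySet (ℤ/-isGroup n) S)
         (sum≢m : ∀ {s t} → s ∈ S → t ∈ S → s ⊕ t ≢ m mod n)
         (m∉S : m mod n ∉ S) where

  private
    G : Graph n
    G = Cay (ℤ/-isGroup n) S isCayleySet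

    h : Fin n
    h = m mod n

  open Graph G
  open IsCayleySet isCayleySet
  open IsGroup (ℤ/-isGroup n) using (inverseʳ; identityʳ)

  -- Read from `v`, such an edge would have `h` as its connecting element, which `m∉S` forbids.
  ¬Adj-⊕half : ∀ {v} → ¬ Adj (v ⊕ h) v
  ¬Adj-⊕half {v} p with symm p
  ... | s , s∈S , vh≡vs = m∉S (subst (_∈ S) (sym (⊕-cancelˡ v vh≡vs)) s∈S)

  -- If `w` is `u ⊕ t` and `w ⊕ h` is `u ⊕ s`, then `s ⊕ ⊖ t` is `h`. By symmetry `⊖ t` lies in `S`,
  -- so this is a forbidden sum of two elements of `S`.
  ¬commonNeighbour-⊕half : ∀ {u w} → Adj u w → ¬ Adj u (w ⊕ h)
  ¬commonNeighbour-⊕half {u} (t , t∈S , refl) (s , s∈S , uth≡us) =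
    sum≢m s∈S (symmetric t∈S) (begin
      s ⊕ ⊖ t           ≡⟨ cong (_⊕ ⊖ t) (⊕-cancelˡ u (trans (sym (⊕-assoc u t h)) uth≡us)) ⟨
      t ⊕ h ⊕ ⊖ t       ≡⟨ cong (_⊕ ⊖ t) (⊕-comm t h) ⟩
      h ⊕ t ⊕ ⊖ t       ≡⟨ ⊕-assoc h t (⊖ t) ⟩
      h ⊕ (t ⊕ ⊖ t)     ≡⟨ cong (h ⊕_) (inverseʳ t) ⟩
      h ⊕ 0ₙ            ≡⟨ identityʳ h ⟩
      h                 ∎)
    where open ≡-Reasoning

  totalColoring-odd : ∀ j → m ≤ suc (j * 2) → TotalColoring G (suc (j * 2))
  totalColoring-odd j m≤k = totalColoring-pullback G j residue residue-proper residue-locallyInjective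
    where
    k = suc (j * 2)

    -- As `m ≤ k`, the outer `mod k` keeps the value and merely places the residue modulo `m` among
    -- the `k` colours.
    residue : Fin n → Fin k
    residue v = (toℕ v % m) mod k

    toℕ-residue : ∀ v → toℕ (residue v) ≡ toℕ v % m
    toℕ-residue v = trans (toℕ-mod (toℕ v % m) k)
      (m<n⇒m%n≡m (<-≤-trans (m%n<n (toℕ v) m) m≤k))

    residue-≡ : ∀ v w → residue v ≡ residue w → v ≡ w ⊎ v ≡ w ⊕ h
    residue-≡ v w eq = %-half m*2≡n v w
      (trans (sym (toℕ-residue v)) (trans (cong toℕ eq) (toℕ-residue w)))

    residue-proper : ∀ {u v} → Adj u v → residue u ≢ residue v
    residue-proper {u} {v} p eq with residue-≡ u v eq
    ... | inj₁ u≡v  = irrefl u≡v p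
    ... | inj₂ refl = ¬Adj-⊕half p

    residue-locallyInjective : ∀ {u v w} → Adj u v → Adj u w → v ≢ w → residue v ≢ residue w
    residue-locallyInjective {u} {v} {w} p q v≢w eq with residue-≡ v w eq
    ... | inj₁ v≡w  = v≢w v≡w
    ... | inj₂ refl = ¬commonNeighbour-⊕half q p

theorem3p2 : (n : ℕ) .{{_ : NonZero n}} → 2 ∣ n →
    (S : Subset n) (isCayleySet : IsCayleySet (ℤ/-isGroup n) S) →
    ∣ S ∣ + 2 ≡ n / 2 →
    (∀ {sᵢ sⱼ} → sᵢ ∈ S → sⱼ ∈ S → sᵢ ⊕ sⱼ ≢ (n / 2) mod n) →
    (n / 2) mod n ∉ S →
    let G = Cay (ℤ/-isGroup n) S isCayleySet in
    (χ″ G ≤ n / 2 + 1) × (n / 2 + 1 ≡ Δ G + 3)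
theorem3p2 n 2∣n S isCayleySet ∣S∣+2≡m sum≢m m∉S = χ″≤m+1 , m+1≡Δ+3
  where
  m = n / 2
  G = Cay (ℤ/-isGroup n) S isCayleySet

  instance
    m≢0 : NonZero m
    -- The size condition makes `m` at least 2.
    m≢0 = >-nonZero (subst (0 <_) ∣S∣+2≡m (m≤n⇒m≤o+n ∣ S ∣ (s≤s z≤n)))

  χ″≤m+1 : χ″ G ≤ m + 1
  χ″≤m+1 = begin
    χ″ G               ≤⟨ proj₂ (χ″-isLeast G)
                           (totalColoring-odd (m/n*n≡m 2∣n) S isCayleySet sum≢m m∉S (m / 2) (m≤1+m/2*2 m)) ⟩
    suc (m / 2 * 2)    ≤⟨ s≤s (m/n*n≤m m 2) ⟩
    suc m              ≡⟨ +-comm 1 m ⟩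
    m + 1              ∎
    where open ≤-Reasoning

  m+1≡Δ+3 : m + 1 ≡ Δ G + 3
  m+1≡Δ+3 = begin
    m + 1              ≡⟨ cong (_+ 1) ∣S∣+2≡m ⟨
    ∣ S ∣ + 2 + 1      ≡⟨ +-assoc ∣ S ∣ 2 1 ⟩
    ∣ S ∣ + 3          ≡⟨ cong (_+ 3) (Δ-Cay (ℤ/-isGroup n) S isCayleySet) ⟨
    Δ G + 3            ∎
    where open ≡-Reasoning
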